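{- Let $\langle S,L,\tau,\ell\rangle$ be a labelled Markov chain and let $s,t\in S$ with $s\simeq t$. Then the function $\delta_{\_}(s,t):(S\to\mathcal{D}(S))\to[0,1]$, $\sigma\mapsto\delta_\sigma(s,t)$, is continuous at $\tau$; that is, for every sequence $(\tau_n)_n$ of transition functions $\tau_n:S\to\mathcal{D}(S)$ converging to $\tau$ we have $\lim_n \delta_{\tau_n}(s,t)=0$.
   Context: A labelled Markov chain is a tuple $\langle S,L,\tau,\ell\rangle$ with $S$ a finite set of states, $L$ a finite set of labels, $\tau:S\to\mathcal{D}(S)$ a transition function ($\mathcal{D}(X)$ = probability distributions on $X$) and $\ell:S\to L$ a labelling; assume $|\ell(S)|\ge 2$. For $\mu,\nu\in\mathcal{D}(X)$, the set of couplings is $\Omega(\mu,\nu)=\{\omega\in\mathcal{D}(X\times X)\mid \forall x:\ \sum_y\omega(x,y)=\mu(x),\ \sum_y\omega(y,x)=\nu(x)\}$. Transition functions $S\to\mathcal{D}(S)$ are equipped with the metric $d_F(\sigma,\tau)=\max_{s\in S}\max_{x\in S}|\sigma(s)(x)-\tau(s)(x)|$, and convergence refers to this metric. The probabilistic bisimilarity distance $\delta_\tau:S\times S\to[0,1]$ is the least fixed point of $\Delta_\tau$, where $\Delta_\tau(d)(s,t)=1$ if $\ell(s)\ne\ell(t)$ and $\Delta_\tau(d)(s,t)=\inf_{\omega\in\Omega(\tau(s),\tau(t))}\sum_{u,v}\omega(u,v)d(u,v)$ otherwise. Let $S^2_\Delta=\{(s,s)\mid s\in S\}$, $S^2_1=\{(s,t)\mid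 \ell(s)\ne\ell(t)\}$, $S^2_{0?}=(S\times S)\setminus(S^2_\Delta\cup S^2_1)$. A policy for $\tau$ is a map $P:S\times S\to\mathcal{D}(S\times S)$ such that $P(s,t)\in\Omega(\tau(s),\tau(t))$ for all $(s,t)\in S^2_\Delta\cup S^2_{0?}$, and $P(s,t)$ is the point mass on $(s,t)$ for $(s,t)\in S^2_1$; $\mathcal{P}_\tau$ denotes the set of policies, and each $P$ induces a Markov chain $\langle S\times S,P\rangle$. Robust bisimilarity: $s\simeq t$ iff there is $P\in\mathcal{P}_\tau$ such that $(s,t)$ reaches $S^2_\Delta$ with probability $1$ in $\langle S\times S,P\rangle$. -}

module Defs where

open import Level using (0ℓ)
open import Algebra.Bundles using (CommutativeRing)
open import Algebra.Structures using (IsCommutativeRing)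
import Algebra.Construct.NaturalChoice.Max as NaturalChoiceMax
import Algebra.Properties.Ring as RingProperties
import Algebra.Properties.Semiring.Sum as SemiringSum
open import Data.Bool.Base using (if_then_else_)
open import Data.Fin.Base using (Fin; zero; suc)
import Data.Fin.Properties as Fin
open import Data.Nat.Base as ℕ using (ℕ; zero; suc)
open import Data.Product.Base using (Σ; Σ-syntax; ∃; ∃-syntax; ∃₂; _×_; _,_; proj₁; proj₂)
import Data.Product.Properties as Product
open import Data.Sum.Base using (_⊎_; inj₁; inj₂)
open import Data.Vec.Base using (Vec; []; _∷_)
open import Data.Vec.Functional using (foldr)
open import Data.Vec.Relation.Unary.Any using (any?)
open import Relation.Binary.Bundles using (TotalOrder)
open import Relation.Binary.Definitions using (DecidableEquality)
open import Relation.Binary.PropositionalEquality.Core using (_≡_; _≢_)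
open import Relation.Binary.Structures using (IsDecTotalOrder)
open import Relation.Nullary.Decidable.Core using (Dec; yes; no; does)
open import Relation.Nullary.Negation.Core using (¬_)
open import Relation.Unary using (Pred; Decidable)

-- The real numbers, axiomatised as a Dedekind-complete ordered field.  Equality
-- is a setoid equality, so that e.g. Cauchy sequences of rationals can (using
-- excluded middle) serve as a model.
record CompleteOrderedField : Set₁ where
  infix  8 -_
  infixl 7 _*_
  infixl 6 _+_ _-_
  infix  4 _≈_ _≤_ _<_
  field
    Carrier : Set
    _≈_ _≤_ : Carrier → Carrier → Set
    _+_ _*_ : Carrier → Carrier → Carrier
    -_      : Carrier → Carrier
    0# 1#   : Carrier

    isCommutativeRing : IsCommutativeRing _≈_ _+_ _*_ -_ 0# 1#
    0≉1               : ¬ 0# ≈ 1#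
    inverse           : ∀ x → ¬ x ≈ 0# → ∃[ y ] x * y ≈ 1#

    isDecTotalOrder   : IsDecTotalOrder _≈_ _≤_
    +-monoˡ-≤         : ∀ z {x y} → x ≤ y → x + z ≤ y + z
    *-nonNegative     : ∀ {x y} → 0# ≤ x → 0# ≤ y → 0# ≤ x * y

  _<_ : Carrier → Carrier → Set
  x < y = x ≤ y × ¬ x ≈ y

  _-_ : Carrier → Carrier → Carrier
  x - y = x + - y

  IsUpperBound : Pred Carrier 0ℓ → Pred Carrier 0ℓ
  IsUpperBound P b = ∀ x → P x → x ≤ b

  IsLowerBound : Pred Carrier 0ℓ → Pred Carrier 0ℓ
  IsLowerBound P b = ∀ x → P x → b ≤ x

  IsSupremum : Pred Carrier 0ℓ → Pred Carrier 0ℓ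
  IsSupremum P b = IsUpperBound P b × (∀ c → IsUpperBound P c → b ≤ c)

  IsInfimum : Pred Carrier 0ℓ → Pred Carrier 0ℓ
  IsInfimum P b = IsLowerBound P b × (∀ c → IsLowerBound P c → c ≤ b)

  field
    supremum : (P : Pred Carrier 0ℓ) → ∃ P → ∃ (IsUpperBound P) → ∃ (IsSupremum P)

  infimum : (P : Pred Carrier 0ℓ) → ∃ P → ∃ (IsLowerBound P) → ∃ (IsInfimum P)
  infimum P (x , Px) bounded =
    let b , upper , least = supremum (IsLowerBound P) bounded (x , λ c c≤P → c≤P x Px)
    in  b , (λ y Py → least y (λ c c≤P → c≤P y Py)) , upper

  commutativeRing : CommutativeRing 0ℓ 0ℓ
  commutativeRing = record { isCommutativeRing = isCommutativeRing }

  open IsDecTotalOrder isDecTotalOrder public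
    using (isTotalOrder; _≟_; _≤?_; total; antisym)
    renaming (refl to ≤-refl; trans to ≤-trans; reflexive to ≤-reflexive)

  totalOrder : TotalOrder 0ℓ 0ℓ 0ℓ
  totalOrder = record { isTotalOrder = isTotalOrder }

  open NaturalChoiceMax totalOrder public using (_⊔_)

  ∣_∣ : Carrier → Carrier
  ∣ x ∣ = x ⊔ - x

  infix 4 _⟶_
  _⟶_ : (ℕ → Carrier) → Carrier → Set
  x ⟶ a = ∀ ε → 0# < ε → ∃[ N ] (∀ k → N ℕ.≤ k → ∣ x k - a ∣ < ε)

data Finite : Set where
  fin : ℕ → Finite
  _⊗_ : Finite → Finite → Finite

⟦_⟧ : Finite → Set
⟦ fin n ⟧ = Fin n
⟦ A ⊗ B ⟧ = ⟦ A ⟧ × ⟦ B ⟧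

_≟⟦⟧_ : ∀ {A} → DecidableEquality ⟦ A ⟧
_≟⟦⟧_ {fin n} = Fin._≟_
_≟⟦⟧_ {A ⊗ B} = Product.≡-dec (_≟⟦⟧_ {A}) (_≟⟦⟧_ {B})

module Probability (ℝ : CompleteOrderedField) where
  open CompleteOrderedField ℝ public
  private
    module R where
      open CommutativeRing commutativeRing public
      open RingProperties ring public
      open SemiringSum semiring public

  ∑ : (A : Finite) → (⟦ A ⟧ → Carrier) → Carrier
  ∑ (fin n) f = R.sum f
  ∑ (A ⊗ B) f = ∑ A (λ a → ∑ B (λ b → f (a , b)))

  indicator : ∀ {P : Set} → Dec P → Carrier
  indicator P? = if does P? then 1# else 0#

  record 𝒟 (A : Finite) : Set where
    field
      mass        : ⟦ A ⟧ → Carrier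
      nonNegative : ∀ x → 0# ≤ mass x
      total-mass  : ∑ A mass ≈ 1#
  open 𝒟 public

  IsPointMass : ∀ {A} → ⟦ A ⟧ → 𝒟 A → Set
  IsPointMass {A} x μ = ∀ y → mass μ y ≈ indicator (_≟⟦⟧_ {A} y x)

  Ω : ∀ {A} → 𝒟 A → 𝒟 A → Pred (𝒟 (A ⊗ A)) 0ℓ
  Ω {A} μ ν ω =
    ∀ x → ∑ A (λ y → mass ω (x , y)) ≈ mass μ x × ∑ A (λ y → mass ω (y , x)) ≈ mass ν x

  𝔼 : ∀ {A} → 𝒟 A → (⟦ A ⟧ → Carrier) → Carrier
  𝔼 {A} μ f = ∑ A (λ x → mass μ x * f x)

  record UnitValued (X : Set) : Set where
    field
      value : X → Carrier
      lower : ∀ x → 0# ≤ value x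
      upper : ∀ x → value x ≤ 1#
  open UnitValued public

  infix 4 _≈ᵘ_ _≤ᵘ_
  _≈ᵘ_ _≤ᵘ_ : ∀ {X} → UnitValued X → UnitValued X → Set
  f ≈ᵘ g = ∀ x → value f x ≈ value g x
  f ≤ᵘ g = ∀ x → value f x ≤ value g x

  IsLeastFixedPoint : ∀ {X} → (UnitValued X → UnitValued X) → UnitValued X → Set
  IsLeastFixedPoint F f = F f ≈ᵘ f × (∀ g → F g ≈ᵘ g → f ≤ᵘ g)

  ∑-paths : (A : Finite) (k : ℕ) → (Vec ⟦ A ⟧ k → Carrier) → Carrier
  ∑-paths A zero    f = f []
  ∑-paths A (suc k) f = ∑ A (λ x → ∑-paths A k (λ π → f (x ∷ π)))

  -- Probability of the cylinder set spanned by the finite path x ∷ π, for the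
  -- chain started in x.
  cylinder : ∀ {A k} → (⟦ A ⟧ → 𝒟 A) → ⟦ A ⟧ → Vec ⟦ A ⟧ k → Carrier
  cylinder P x []      = 1#
  cylinder {A} P x (y ∷ π) = mass (P x) y * cylinder {A} P y π

  -- Probability that the chain started in x visits B within its first k steps.
  reach≤ : ∀ {A} → (⟦ A ⟧ → 𝒟 A) → {B : Pred ⟦ A ⟧ 0ℓ} → Decidable B → ⟦ A ⟧ → ℕ → Carrier
  reach≤ {A} P B? x k = ∑-paths A k (λ π → indicator (any? B? (x ∷ π)) * cylinder {A} P x π)

  -- The event "reach B" is the increasing union over k of the events "reach B
  -- within k steps", so its probability is the limit of theirs.
  ReachesWithProbability :
    ∀ {A} → Carrier → (⟦ A ⟧ → 𝒟 A) → {B : Pred ⟦ A ⟧ 0ℓ} → Decidable B → ⟦ A ⟧ → Set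
  ReachesWithProbability {A} p P B? x = reach≤ {A} P B? x ⟶ p

  ≤-respˡ : ∀ {x y z} → x ≈ y → x ≤ z → y ≤ z
  ≤-respˡ x≈y = ≤-trans (≤-reflexive (R.sym x≈y))

  ≤-respʳ : ∀ {x y z} → x ≈ y → z ≤ x → z ≤ y
  ≤-respʳ x≈y z≤x = ≤-trans z≤x (≤-reflexive x≈y)

  +-mono-≤ : ∀ {x y u v} → x ≤ y → u ≤ v → x + u ≤ y + v
  +-mono-≤ {x} {y} {u} {v} x≤y u≤v =
    ≤-trans (+-monoˡ-≤ u x≤y)
      (≤-respˡ (R.+-comm u y) (≤-respʳ (R.+-comm v y) (+-monoˡ-≤ y u≤v)))

  x≤y⇒0≤y-x : ∀ {x y} → x ≤ y → 0# ≤ y - x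
  x≤y⇒0≤y-x {x} x≤y = ≤-respˡ (R.-‿inverseʳ x) (+-monoˡ-≤ (- x) x≤y)

  0≤y-x⇒x≤y : ∀ {x y} → 0# ≤ y - x → x ≤ y
  0≤y-x⇒x≤y {x} {y} 0≤y-x =
    ≤-respˡ (R.+-identityˡ x) (≤-respʳ y-x+x≈y (+-monoˡ-≤ x 0≤y-x))
    where
    y-x+x≈y : y - x + x ≈ y
    y-x+x≈y = R.trans (R.+-assoc y (- x) x)
                (R.trans (R.+-congˡ (R.-‿inverseˡ x)) (R.+-identityʳ y))

  *-monoʳ-≤ : ∀ z {x y} → 0# ≤ z → x ≤ y → z * x ≤ z * y
  *-monoʳ-≤ z {x} {y} 0≤z x≤y =
    0≤y-x⇒x≤y (≤-respʳ z[y-x] (*-nonNegative 0≤z (x≤y⇒0≤y-x x≤y)))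
    where
    z[y-x] : z * (y - x) ≈ z * y - z * x
    z[y-x] = R.trans (R.distribˡ z y (- x)) (R.+-congˡ (R.sym (R.-‿distribʳ-* z x)))

  0≤1 : 0# ≤ 1#
  0≤1 with total 0# 1#
  ... | inj₁ 0≤1′ = 0≤1′
  ... | inj₂ 1≤0  =
    ≤-respʳ (R.trans (R.sym (R.-‿distribʳ-* (- 1#) 1#))
              (R.trans (R.-‿cong (R.*-identityʳ (- 1#))) (R.-‿involutive 1#)))
      (*-nonNegative 0≤-1 0≤-1)
    where
    0≤-1 : 0# ≤ - 1#
    0≤-1 = ≤-respʳ (R.+-identityˡ (- 1#)) (x≤y⇒0≤y-x 1≤0)

  ∑-cong : ∀ A {f g} → (∀ x → f x ≈ g x) → ∑ A f ≈ ∑ A g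
  ∑-cong (fin n) f≈g = R.sum-cong-≋ f≈g
  ∑-cong (A ⊗ B) f≈g = ∑-cong A (λ a → ∑-cong B (λ b → f≈g (a , b)))

  sum-mono : ∀ {n} {f g : Fin n → Carrier} → (∀ x → f x ≤ g x) → R.sum f ≤ R.sum g
  sum-mono {zero}  f≤g = ≤-refl
  sum-mono {suc n} f≤g = +-mono-≤ (f≤g zero) (sum-mono (λ i → f≤g (suc i)))

  ∑-mono : ∀ A {f g} → (∀ x → f x ≤ g x) → ∑ A f ≤ ∑ A g
  ∑-mono (fin n) f≤g = sum-mono f≤g
  ∑-mono (A ⊗ B) f≤g = ∑-mono A (λ a → ∑-mono B (λ b → f≤g (a , b)))

  ∑-zero : ∀ A → ∑ A (λ _ → 0#) ≈ 0#
  ∑-zero (fin n) = R.sum-replicate-zero n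
  ∑-zero (A ⊗ B) = R.trans (∑-cong A (λ _ → ∑-zero B)) (∑-zero A)

  *-distribˡ-∑ : ∀ A c f → c * ∑ A f ≈ ∑ A (λ x → c * f x)
  *-distribˡ-∑ (fin n) c f = R.*-distribˡ-sum c f
  *-distribˡ-∑ (A ⊗ B) c f =
    R.trans (*-distribˡ-∑ A c _) (∑-cong A (λ a → *-distribˡ-∑ B c _))

  𝔼-mono : ∀ {A} (μ : 𝒟 A) {f g} → (∀ x → f x ≤ g x) → 𝔼 μ f ≤ 𝔼 μ g
  𝔼-mono {A} μ f≤g = ∑-mono A (λ x → *-monoʳ-≤ (mass μ x) (nonNegative μ x) (f≤g x))

  𝔼-lower : ∀ {A} (μ : 𝒟 A) (f : UnitValued ⟦ A ⟧) → 0# ≤ 𝔼 μ (value f)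
  𝔼-lower {A} μ f =
    ≤-respˡ (∑-zero A) (∑-mono A (λ x → *-nonNegative (nonNegative μ x) (lower f x)))

  𝔼-upper : ∀ {A} (μ : 𝒟 A) (f : UnitValued ⟦ A ⟧) → 𝔼 μ (value f) ≤ 1#
  𝔼-upper {A} μ f =
    ≤-respʳ (R.trans (∑-cong A (λ x → R.*-identityʳ (mass μ x))) (total-mass μ))
      (𝔼-mono μ (upper f))

  productCoupling : ∀ {A} (μ ν : 𝒟 A) → ∃ (Ω μ ν)
  productCoupling {A} μ ν = ω , λ x → left x , right x
    where
    left : ∀ x → ∑ A (λ y → mass μ x * mass ν y) ≈ mass μ x
    left x = R.trans (R.sym (*-distribˡ-∑ A (mass μ x) (mass ν)))
               (R.trans (R.*-congˡ (total-mass ν)) (R.*-identityʳ (mass μ x)))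

    right : ∀ x → ∑ A (λ y → mass μ y * mass ν x) ≈ mass ν x
    right x = R.trans (∑-cong A (λ y → R.*-comm (mass μ y) (mass ν x)))
                (R.trans (R.sym (*-distribˡ-∑ A (mass ν x) (mass μ)))
                  (R.trans (R.*-congˡ (total-mass μ)) (R.*-identityʳ (mass ν x))))

    ω : 𝒟 (A ⊗ A)
    ω = record
      { mass        = λ (x , y) → mass μ x * mass ν y
      ; nonNegative = λ (x , y) → *-nonNegative (nonNegative μ x) (nonNegative ν y)
      ; total-mass  = R.trans (∑-cong A left) (total-mass μ)
      }

  -- Knaster–Tarski on [0,1]-valued functions.
  leastFixedPoint : ∀ {X} (F : UnitValued X → UnitValued X) →
    (∀ {f g} → f ≤ᵘ g → F f ≤ᵘ F g) → ∃ (IsLeastFixedPoint F)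
  leastFixedPoint {X} F mono = μF , (λ x → antisym (pre x) (post x)) , least
    where
    Values : X → Pred Carrier 0ℓ
    Values x r = ∃[ f ] F f ≤ᵘ f × value f x ≈ r

    top : UnitValued X
    top = record { value = λ _ → 1# ; lower = λ _ → 0≤1 ; upper = λ _ → ≤-refl }

    0-lowerBound : ∀ x → IsLowerBound (Values x) 0#
    0-lowerBound x r (f , _ , fx≈r) = ≤-respʳ fx≈r (lower f x)

    inf : ∀ x → ∃ (IsInfimum (Values x))
    inf x = infimum (Values x) (1# , top , (λ y → upper (F top) y) , R.refl) (0# , 0-lowerBound x)

    below : ∀ f → F f ≤ᵘ f → ∀ x → proj₁ (inf x) ≤ value f x
    below f pre-f x = proj₁ (proj₂ (inf x)) (value f x) (f , pre-f , R.refl)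

    μF : UnitValued X
    μF = record
      { value = λ x → proj₁ (inf x)
      ; lower = λ x → proj₂ (proj₂ (inf x)) 0# (0-lowerBound x)
      ; upper = λ x → below top (λ y → upper (F top) y) x
      }

    pre : F μF ≤ᵘ μF
    pre x = proj₂ (proj₂ (inf x)) (value (F μF) x)
      λ { r (f , pre-f , fx≈r) → ≤-respʳ fx≈r (≤-trans (mono {μF} {f} (below f pre-f) x) (pre-f x)) }

    post : μF ≤ᵘ F μF
    post = below (F μF) (mono {F μF} {μF} pre)

    least : ∀ g → F g ≈ᵘ g → μF ≤ᵘ g
    least g Fg≈g = below g (λ x → ≤-reflexive (Fg≈g x))

  Transition : ℕ → Set
  Transition n = Fin n → 𝒟 (fin n)

  -- Only applied to non-negative families, for which starting from 0 is harmless.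
  maximum : ∀ {n} → (Fin n → Carrier) → Carrier
  maximum = foldr _⊔_ 0#

  d_F : ∀ {n} → Transition n → Transition n → Carrier
  d_F σ τ = maximum (λ s → maximum (λ x → ∣ mass (σ s) x - mass (τ s) x ∣))

  Converges : ∀ {n} → (ℕ → Transition n) → Transition n → Set
  Converges τₖ τ = ∀ ε → 0# < ε → ∃[ N ] (∀ k → N ℕ.≤ k → d_F (τₖ k) τ < ε)

  ContinuousAt : ∀ {n} → (Transition n → Carrier) → Transition n → Set
  ContinuousAt f τ =
    ∀ ε → 0# < ε → ∃[ η ] 0# < η × (∀ σ → d_F σ τ < η → ∣ f σ - f τ ∣ < ε)

  record LabelledMarkovChain : Set where
    field
      numStates numLabels : ℕ

    S : Set
    S = Fin numStates

    L : Set
    L = Fin numLabels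

    field
      τ         : Transition numStates
      ℓ         : S → L
      twoLabels : ∃₂ λ s t → ℓ s ≢ ℓ t

  module Distance {n m} (ℓ : Fin n → Fin m) where

    CouplingCosts : Transition n → UnitValued (Fin n × Fin n) → Fin n → Fin n → Pred Carrier 0ℓ
    CouplingCosts τ d s t r = ∃[ ω ] Ω (τ s) (τ t) ω × 𝔼 ω (value d) ≈ r

    private
      0-lowerBound : ∀ τ d s t → IsLowerBound (CouplingCosts τ d s t) 0#
      0-lowerBound τ d s t r (ω , _ , eq) = ≤-respʳ eq (𝔼-lower ω d)

    optimalCost : ∀ τ d s t → ∃ (IsInfimum (CouplingCosts τ d s t))
    optimalCost τ d s t =
      let ω , ω∈Ω = productCoupling (τ s) (τ t)
      in  infimum (CouplingCosts τ d s t)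
            (𝔼 ω (value d) , ω , ω∈Ω , R.refl) (0# , 0-lowerBound τ d s t)

    Δ-value : Transition n → UnitValued (Fin n × Fin n) → Fin n × Fin n → Carrier
    Δ-value τ d (s , t) with ℓ s Fin.≟ ℓ t
    ... | no  _ = 1#
    ... | yes _ = proj₁ (optimalCost τ d s t)

    private
      Δ-lower : ∀ τ d p → 0# ≤ Δ-value τ d p
      Δ-lower τ d (s , t) with ℓ s Fin.≟ ℓ t
      ... | no  _ = 0≤1
      ... | yes _ = proj₂ (proj₂ (optimalCost τ d s t)) 0# (0-lowerBound τ d s t)

      Δ-upper : ∀ τ d p → Δ-value τ d p ≤ 1#
      Δ-upper τ d (s , t) with ℓ s Fin.≟ ℓ t
      ... | no  _ = ≤-refl
      ... | yes _ =
        let ω , ω∈Ω = productCoupling (τ s) (τ t)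
        in  ≤-trans (proj₁ (proj₂ (optimalCost τ d s t)) _ (ω , ω∈Ω , R.refl)) (𝔼-upper ω d)

    Δ : Transition n → UnitValued (Fin n × Fin n) → UnitValued (Fin n × Fin n)
    Δ τ d = record { value = Δ-value τ d ; lower = Δ-lower τ d ; upper = Δ-upper τ d }

    Δ-mono : ∀ τ {d e} → d ≤ᵘ e → Δ τ d ≤ᵘ Δ τ e
    Δ-mono τ {d} {e} d≤e (s , t) with ℓ s Fin.≟ ℓ t
    ... | no  _ = ≤-refl
    ... | yes _ = proj₂ (proj₂ (optimalCost τ e s t)) _
      λ { r (ω , ω∈Ω , eq) → ≤-respʳ eq
            (≤-trans (proj₁ (proj₂ (optimalCost τ d s t)) _ (ω , ω∈Ω , R.refl)) (𝔼-mono ω d≤e)) }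

    distance : ∀ τ → ∃ (IsLeastFixedPoint (Δ τ))
    distance τ = leastFixedPoint (Δ τ) (λ {d} {e} → Δ-mono τ {d} {e})

    δ : Transition n → Fin n × Fin n → Carrier
    δ τ = value (proj₁ (distance τ))

  module Robust (M : LabelledMarkovChain) where
    open LabelledMarkovChain M

    S×S : Finite
    S×S = fin numStates ⊗ fin numStates

    S²Δ S²₁ S²₀? : Pred (S × S) 0ℓ
    S²Δ  (s , t) = s ≡ t
    S²₁  (s , t) = ℓ s ≢ ℓ t
    S²₀? p       = ¬ (S²Δ p ⊎ S²₁ p)

    S²Δ? : Decidable S²Δ
    S²Δ? (s , t) = s Fin.≟ t

    record Policy : Set where
      field
        choose    : S × S → 𝒟 S×S
        coupling  : ∀ s t → S²Δ (s , t) ⊎ S²₀? (s , t) → Ω (τ s) (τ t) (choose (s , t))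
        absorbing : ∀ p → S²₁ p → IsPointMass p (choose p)
    open Policy public

    infix 4 _≃_
    _≃_ : S → S → Set
    s ≃ t = Σ[ P ∈ Policy ] ReachesWithProbability {S×S} 1# (choose P) S²Δ? (s , t)

{-# OPTIONS --safe #-}
module Submission where

-- If σ is η-close to τ, every coupling of τ(s) and τ(t) can be turned into one
-- of σ(s) and σ(t) that raises the expectation of [0,1]-valued functions by at
-- most 2nη.  Following a policy P for τ for k steps with couplings corrected in
-- this way, and using that δ_σ vanishes on the diagonal, gives
--   δ_σ(s,t) ≤ Pr[P does not reach the diagonal from (s,t) in k steps] + 2nkη.
-- For s ≃ t, choose first k and then η to make the right-hand side small.

open import Defs
open import Algebra.Bundles using (CommutativeRing)
import Algebra.Construct.NaturalChoice.Max as NaturalChoiceMax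
import Algebra.Construct.NaturalChoice.Min as NaturalChoiceMin
import Algebra.Properties.Ring as RingProperties
import Algebra.Properties.Semiring.Sum as SemiringSum
import Algebra.Solver.Ring.NaturalCoefficients.Default as RingSolver
open import Data.Bool.Base using (if_then_else_)
open import Data.Fin.Base using (Fin; zero; suc)
import Data.Fin.Properties as Fin
open import Data.Nat.Base using (ℕ; zero; suc)
import Data.Nat.Properties as ℕ
open import Data.Product.Base using (∃-syntax; _×_; _,_; proj₁; proj₂)
open import Data.Sum.Base using (inj₁; inj₂; [_,_]′)
open import Data.Vec.Base using (Vec; []; _∷_)
open import Data.Vec.Relation.Unary.Any using (any?)
open import Function.Base using (_∘_)
open import Level using (0ℓ)
open import Relation.Binary.Bundles using (TotalOrder)
open import Relation.Binary.PropositionalEquality.Core as ≡ using (_≡_; _≢_)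
open import Relation.Nullary.Decidable.Core using (Dec; yes; no; does)
open import Relation.Nullary.Negation.Core using (¬_; contradiction)
open import Relation.Unary using (Pred; Decidable)

module Continuity (ℝ : CompleteOrderedField) where
  open Probability ℝ
  private
    module R where
      open CommutativeRing commutativeRing public
      open RingProperties ring public
      open SemiringSum semiring public
  open NaturalChoiceMax totalOrder using (x≤x⊔y; x≤y⊔x; ⊔-lub)
  open import Relation.Binary.Reasoning.PartialOrder (TotalOrder.poset totalOrder)
  open RingSolver R.commutativeSemiring using (solve; _:=_; _:+_; _:*_; con)

  -- Arithmetic in an ordered field.

  +-monoʳ-≤ : ∀ z {x y} → x ≤ y → z + x ≤ z + y
  +-monoʳ-≤ z = +-mono-≤ (≤-refl {z})

  *-monoˡ-≤ : ∀ z {x y} → 0# ≤ z → x ≤ y → x * z ≤ y * z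
  *-monoˡ-≤ z {x} {y} 0≤z x≤y =
    ≤-respˡ (R.*-comm z x) (≤-respʳ (R.*-comm z y) (*-monoʳ-≤ z 0≤z x≤y))

  +-cancelʳ-≤ : ∀ z {x y} → x + z ≤ y + z → x ≤ y
  +-cancelʳ-≤ z {x} {y} x+z≤y+z =
    ≤-respˡ (cancel x) (≤-respʳ (cancel y) (+-monoˡ-≤ (- z) x+z≤y+z))
    where
    cancel : ∀ w → w + z + - z ≈ w
    cancel w = R.trans (R.+-assoc w z (- z))
                 (R.trans (R.+-congˡ (R.-‿inverseʳ z)) (R.+-identityʳ w))

  x≤x+y : ∀ {x y} → 0# ≤ y → x ≤ x + y
  x≤x+y {x} 0≤y = ≤-respˡ (R.+-identityʳ x) (+-monoʳ-≤ x 0≤y)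

  0≤x+y : ∀ {x y} → 0# ≤ x → 0# ≤ y → 0# ≤ x + y
  0≤x+y 0≤x 0≤y = ≤-trans 0≤x (x≤x+y 0≤y)

  x-y+y≈x : ∀ x y → x - y + y ≈ x
  x-y+y≈x x y = R.trans (R.+-assoc x (- y) y)
                  (R.trans (R.+-congˡ (R.-‿inverseˡ y)) (R.+-identityʳ x))

  ≤⇒∃+ : ∀ {x y} → x ≤ y → ∃[ z ] 0# ≤ z × x + z ≈ y
  ≤⇒∃+ {x} {y} x≤y = y - x , x≤y⇒0≤y-x x≤y , R.trans (R.+-comm x (y - x)) (x-y+y≈x y x)

  ≰⇒> : ∀ {x y} → ¬ y ≤ x → x < y
  ≰⇒> {x} {y} y≰x with total x y
  ... | inj₁ x≤y = x≤y , y≰x ∘ ≤-reflexive ∘ R.sym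
  ... | inj₂ y≤x = contradiction y≤x y≰x

  <⇒≱ : ∀ {x y} → x < y → ¬ y ≤ x
  <⇒≱ (x≤y , x≉y) y≤x = x≉y (antisym x≤y y≤x)

  y-x≤∣x-y∣ : ∀ x y → y - x ≤ ∣ x - y ∣
  y-x≤∣x-y∣ x y = begin
    y - x      ≈⟨ R.+-comm y (- x) ⟩
    - x + y    ≈⟨ R.+-congˡ (R.-‿involutive y) ⟨
    - x - - y  ≈⟨ R.-‿+-comm x (- y) ⟩
    - (x - y)  ≤⟨ x≤y⊔x (x - y) (- (x - y)) ⟩
    ∣ x - y ∣  ∎

  ∣∣<-intro : ∀ {x ε} → 0# ≤ x → x < ε → ∣ x ∣ < ε
  ∣∣<-intro {x} {ε} 0≤x x<ε = ≰⇒> λ ε≤∣x∣ → <⇒≱ x<ε (≤-trans ε≤∣x∣ (⊔-lub ≤-refl -x≤x))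
    where
    -x≤x : - x ≤ x
    -x≤x = +-cancelʳ-≤ x (≤-respˡ (R.sym (R.-‿inverseˡ x)) (0≤x+y 0≤x 0≤x))

  ≤-maximum : ∀ {n} (f : Fin n → Carrier) i → f i ≤ maximum f
  ≤-maximum f zero    = x≤x⊔y _ _
  ≤-maximum f (suc i) = ≤-trans (≤-maximum (f ∘ suc) i) (x≤y⊔x _ _)

  inverse-nonNegative : ∀ {x y} → 0# ≤ x → x * y ≈ 1# → 0# ≤ y
  inverse-nonNegative {x} {y} 0≤x xy≈1 with total 0# y
  ... | inj₁ 0≤y = 0≤y
  ... | inj₂ y≤0 = contradiction (antisym 0≤1 1≤0) 0≉1
    where
    1≤0 : 1# ≤ 0#
    1≤0 = ≤-respˡ xy≈1 (≤-respʳ (R.zeroʳ x) (*-monoʳ-≤ x 0≤x y≤0))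

  -- The divisor `1# + m` is at least 1, hence invertible even if m is 0. The case m = 1 halves ε;
  -- in general the resulting η satisfies `m * η ≤ ε`.
  pos-divide : ∀ {m ε} → 0# ≤ m → 0# < ε → ∃[ η ] 0# < η × (1# + m) * η ≈ ε
  pos-divide {m} {ε} 0≤m (0≤ε , 0≉ε) = i * ε , (*-nonNegative 0≤i 0≤ε , 0≉iε) , eq
    where
    1≤1+m : 1# ≤ 1# + m
    1≤1+m = x≤x+y 0≤m

    inv : ∃[ y ] (1# + m) * y ≈ 1#
    inv = inverse (1# + m) λ 1+m≈0 → 0≉1 (antisym 0≤1 (≤-respʳ 1+m≈0 1≤1+m))

    i : Carrier
    i = proj₁ inv

    0≤i : 0# ≤ i
    0≤i = inverse-nonNegative (≤-trans 0≤1 1≤1+m) (proj₂ inv)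

    eq : (1# + m) * (i * ε) ≈ ε
    eq = R.trans (R.sym (R.*-assoc _ i ε)) (R.trans (R.*-congʳ (proj₂ inv)) (R.*-identityˡ ε))

    0≉iε : ¬ 0# ≈ i * ε
    0≉iε 0≈iε = 0≉ε (R.trans (R.sym (R.zeroʳ (1# + m))) (R.trans (R.*-congˡ 0≈iε) eq))

  -- Finite sums and expectations.

  ∑-+ : ∀ A f g → ∑ A (λ x → f x + g x) ≈ ∑ A f + ∑ A g
  ∑-+ (fin n) f g = R.∑-distrib-+ f g
  ∑-+ (A ⊗ B) f g = R.trans (∑-cong A (λ a → ∑-+ B _ _)) (∑-+ A _ _)

  *-distribʳ-∑ : ∀ A c f → ∑ A f * c ≈ ∑ A (λ x → f x * c)
  *-distribʳ-∑ A c f =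
    R.trans (R.*-comm _ c) (R.trans (*-distribˡ-∑ A c f) (∑-cong A (λ x → R.*-comm c (f x))))

  ∑-swap : ∀ A B (f : ⟦ A ⟧ → ⟦ B ⟧ → Carrier) →
    ∑ A (λ a → ∑ B (λ b → f a b)) ≈ ∑ B (λ b → ∑ A (λ a → f a b))
  ∑-swap (fin n) (fin m)   f = R.∑-comm f
  ∑-swap (fin n) (B ⊗ B′)  f =
    R.trans (∑-swap (fin n) B _) (∑-cong B (λ b → ∑-swap (fin n) B′ _))
  ∑-swap (A ⊗ A′) B        f =
    R.trans (∑-cong A (λ a → ∑-swap A′ B _)) (∑-swap A B _)

  ∑-nonNegative : ∀ A {f} → (∀ x → 0# ≤ f x) → 0# ≤ ∑ A f
  ∑-nonNegative A 0≤f = ≤-respˡ (∑-zero A) (∑-mono A 0≤f)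

  ∑-single : ∀ A f (x : ⟦ A ⟧) → (∀ y → y ≢ x → f y ≈ 0#) → ∑ A f ≈ f x
  ∑-single (fin (suc n)) f zero    f≈0 =
    R.trans (R.+-congˡ (R.trans (∑-cong (fin n) (λ i → f≈0 (suc i) λ ())) (∑-zero (fin n))))
      (R.+-identityʳ _)
  ∑-single (fin (suc n)) f (suc x) f≈0 =
    R.trans (R.+-cong (f≈0 zero λ ())
               (∑-single (fin n) (f ∘ suc) x (λ y y≢x → f≈0 (suc y) (y≢x ∘ Fin.suc-injective))))
      (R.+-identityˡ _)
  ∑-single (A ⊗ B) f (a , b) f≈0 =
    R.trans
      (∑-single A _ a λ a′ a′≢a →
        R.trans (∑-cong B (λ b′ → f≈0 (a′ , b′) (a′≢a ∘ ≡.cong proj₁))) (∑-zero B))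
      (∑-single B _ b λ b′ b′≢b → f≈0 (a , b′) (b′≢b ∘ ≡.cong proj₂))

  term≤∑ : ∀ A f (x : ⟦ A ⟧) → (∀ y → 0# ≤ f y) → f x ≤ ∑ A f
  term≤∑ (fin (suc n)) f zero    0≤f = x≤x+y (∑-nonNegative (fin n) (0≤f ∘ suc))
  term≤∑ (fin (suc n)) f (suc x) 0≤f =
    ≤-trans (term≤∑ (fin n) (f ∘ suc) x (0≤f ∘ suc))
      (≤-respʳ (R.+-comm _ _) (x≤x+y (0≤f zero)))
  term≤∑ (A ⊗ B) f (a , b) 0≤f =
    ≤-trans (term≤∑ B _ b (λ b′ → 0≤f (a , b′)))
      (term≤∑ A _ a (λ a′ → ∑-nonNegative B (λ b′ → 0≤f (a′ , b′))))

  ∑-const : ∀ A c → ∑ A (λ _ → c) ≈ ∑ A (λ _ → 1#) * c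
  ∑-const A c = R.trans (∑-cong A (λ _ → R.sym (R.*-identityˡ c))) (R.sym (*-distribʳ-∑ A c _))

  𝔼-+ : ∀ {A} (μ : 𝒟 A) f g → 𝔼 μ (λ x → f x + g x) ≈ 𝔼 μ f + 𝔼 μ g
  𝔼-+ {A} μ f g = R.trans (∑-cong A (λ x → R.distribˡ (mass μ x) (f x) (g x))) (∑-+ A _ _)

  𝔼-const : ∀ {A} (μ : 𝒟 A) c → 𝔼 μ (λ _ → c) ≈ c
  𝔼-const {A} μ c =
    R.trans (R.sym (*-distribʳ-∑ A c (mass μ)))
      (R.trans (R.*-congʳ (total-mass μ)) (R.*-identityˡ c))

  𝔼-pointMass : ∀ {A} (μ : 𝒟 A) x f → IsPointMass {A} x μ → 𝔼 μ f ≈ f x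
  𝔼-pointMass {A} μ x f point = R.trans (∑-single A _ x off) (R.trans (R.*-congʳ on) (R.*-identityˡ (f x)))
    where
    off : ∀ y → y ≢ x → mass μ y * f y ≈ 0#
    off y y≢x with _≟⟦⟧_ {A} y x | point y
    ... | yes y≡x | _    = contradiction y≡x y≢x
    ... | no  _   | μy≈0 = R.trans (R.*-congʳ μy≈0) (R.zeroˡ (f y))

    on : mass μ x ≈ 1#
    on with _≟⟦⟧_ {A} x x | point x
    ... | yes _  | μx≈1 = μx≈1
    ... | no x≢x | _    = contradiction ≡.refl x≢x

  -- Couplings: the diagonal one, and the correction of a coupling to nearby marginals.

  -- All mass sits on pairs (x , x), so the expectation sees only the diagonal values of f. This
  -- supplies the coupling of cost 0 behind `δ-diagonal`.
  diagonalCoupling : ∀ {n} (μ : 𝒟 (fin n)) →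
    ∃[ ω ] Ω μ μ ω × (∀ f → (∀ x → f (x , x) ≈ 0#) → 𝔼 ω f ≈ 0#)
  diagonalCoupling {n} μ = ω , (λ x → left x , right x) , cost
    where
    m : Fin n × Fin n → Carrier
    m (x , y) = if does (x Fin.≟ y) then mass μ x else 0#

    on : ∀ x → m (x , x) ≈ mass μ x
    on x with x Fin.≟ x
    ... | yes _  = R.refl
    ... | no x≢x = contradiction ≡.refl x≢x

    off : ∀ {x y} → x ≢ y → m (x , y) ≈ 0#
    off {x} {y} x≢y with x Fin.≟ y
    ... | yes x≡y = contradiction x≡y x≢y
    ... | no _    = R.refl

    left : ∀ x → ∑ (fin n) (λ y → m (x , y)) ≈ mass μ x
    left x = R.trans (∑-single (fin n) _ x (λ y y≢x → off (y≢x ∘ ≡.sym))) (on x)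

    right : ∀ x → ∑ (fin n) (λ y → m (y , x)) ≈ mass μ x
    right x = R.trans (∑-single (fin n) _ x (λ y → off)) (on x)

    nonNeg : ∀ p → 0# ≤ m p
    nonNeg (x , y) with x Fin.≟ y
    ... | yes _ = nonNegative μ x
    ... | no  _ = ≤-refl

    ω : 𝒟 (fin n ⊗ fin n)
    ω = record
      { mass        = m
      ; nonNegative = nonNeg
      ; total-mass  = R.trans (∑-cong (fin n) left) (total-mass μ)
      }

    cost : ∀ f → (∀ x → f (x , x) ≈ 0#) → 𝔼 ω f ≈ 0#
    cost f f≈0 = R.trans (∑-cong (fin n ⊗ fin n) term) (∑-zero (fin n ⊗ fin n))
      where
      term : ∀ p → m p * f p ≈ 0#
      term (x , y) with x Fin.≟ y
      ... | yes ≡.refl = R.trans (R.*-congˡ (f≈0 x)) (R.zeroʳ _)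
      ... | no  _      = R.zeroˡ _

  -- A factor scaling p down to p ⊓ q; the choice is free where p ≈ 0#.
  record Shrinking (p q : Carrier) : Set where
    field
      factor rest : Carrier
      0≤factor    : 0# ≤ factor
      0≤rest      : 0# ≤ rest
      complement  : factor + rest ≈ 1#
      kept≤       : p * factor ≤ q
      removed≤    : ∀ {η} → 0# ≤ η → p ≤ q + η → p * rest ≤ η

    factor≤1 : factor ≤ 1#
    factor≤1 = ≤-respʳ complement (x≤x+y 0≤rest)

  -- Nothing is removed when p ≤ q. Otherwise the factor is q / p and the rest (p - q) / p; here p
  -- is invertible, since `p ≈ 0#` would give p ≤ q.
  shrink : ∀ {p q} → 0# ≤ p → 0# ≤ q → Shrinking p q
  shrink {p} {q} 0≤p 0≤q with p ≤? q
  ... | yes p≤q = record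
    { factor     = 1#
    ; rest       = 0#
    ; 0≤factor   = 0≤1
    ; 0≤rest     = ≤-refl
    ; complement = R.+-identityʳ 1#
    ; kept≤      = ≤-respˡ (R.sym (R.*-identityʳ p)) p≤q
    ; removed≤   = λ 0≤η _ → ≤-respˡ (R.sym (R.zeroʳ p)) 0≤η
    }
  ... | no p≰q = record
    { factor     = q * i
    ; rest       = z * i
    ; 0≤factor   = *-nonNegative 0≤q 0≤i
    ; 0≤rest     = *-nonNegative 0≤z 0≤i
    ; complement = R.trans (R.sym (R.distribʳ i q z)) (R.trans (R.*-congʳ q+z≈p) pi≈1)
    ; kept≤      = ≤-reflexive (cancel q)
    ; removed≤   = λ {η} _ p≤q+η → ≤-respˡ (R.sym (cancel z))
        (+-cancelʳ-≤ q (≤-respˡ (R.trans (R.sym q+z≈p) (R.+-comm q z)) (≤-respʳ (R.+-comm q η) p≤q+η)))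
    }
    where
    inv : ∃[ y ] p * y ≈ 1#
    inv = inverse p (λ p≈0 → p≰q (≤-respˡ (R.sym p≈0) 0≤q))

    i : Carrier
    i = proj₁ inv

    pi≈1 : p * i ≈ 1#
    pi≈1 = proj₂ inv

    0≤i : 0# ≤ i
    0≤i = inverse-nonNegative 0≤p pi≈1

    diff : ∃[ z ] 0# ≤ z × q + z ≈ p
    diff = ≤⇒∃+ (proj₁ (≰⇒> p≰q))

    z : Carrier
    z = proj₁ diff

    0≤z : 0# ≤ z
    0≤z = proj₁ (proj₂ diff)

    q+z≈p : q + z ≈ p
    q+z≈p = proj₂ (proj₂ diff)

    cancel : ∀ w → p * (w * i) ≈ w
    cancel w = R.trans (solve 3 (λ p w i → p :* (w :* i) := w :* (p :* i)) R.refl p w i)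
                 (R.trans (R.*-congˡ pi≈1) (R.*-identityʳ w))

  -- Division by a total that may vanish: if x is 0, every r between 0 and x is 0 as well, so the
  -- default value i = 0 cancels correctly.
  pseudoInverse : ∀ x → 0# ≤ x → ∃[ i ] 0# ≤ i × (∀ {r} → 0# ≤ r → r ≤ x → r * (x * i) ≈ r)
  pseudoInverse x 0≤x with x ≟ 0#
  ... | yes x≈0 = 0# , ≤-refl , λ {r} 0≤r r≤x →
    let r≈0 = antisym (≤-respʳ x≈0 r≤x) 0≤r
    in  R.trans (R.*-congʳ r≈0) (R.trans (R.zeroˡ _) (R.sym r≈0))
  ... | no x≉0 = let i , xi≈1 = inverse x x≉0 in
    i , inverse-nonNegative 0≤x xi≈1 , λ {r} _ _ → R.trans (R.*-congˡ xi≈1) (R.*-identityʳ r)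

  -- ω is shrunk by factors depending on the row and on the column until its
  -- marginals fit under μ′ and ν′; the missing marginals r and q have the same
  -- total, and their normalised product is added back.
  perturbedCoupling : ∀ {A} {μ ν μ′ ν′ : 𝒟 A} {ω η} → Ω μ ν ω → 0# ≤ η →
    (∀ x → mass μ x ≤ mass μ′ x + η) → (∀ x → mass ν x ≤ mass ν′ x + η) →
    ∃[ ω′ ] Ω μ′ ν′ ω′ ×
      (∀ d → 𝔼 ω′ (value d) ≤ 𝔼 ω (value d) + (∑ A (λ _ → 1#) + ∑ A (λ _ → 1#)) * η)
  perturbedCoupling {A} {μ} {ν} {μ′} {ν′} {ω} {η} ω∈Ω 0≤η μ≤ ν≤ =
    ω′ , (λ x → left x , right x) , cost
    where
    module a x = Shrinking (shrink (nonNegative μ x) (nonNegative μ′ x))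
    module b x = Shrinking (shrink (nonNegative ν x) (nonNegative ν′ x))

    a b a̅ b̅ : ⟦ A ⟧ → Carrier
    a = a.factor
    b = b.factor
    a̅ = a.rest
    b̅ = b.rest

    w κ : ⟦ A ⟧ → ⟦ A ⟧ → Carrier
    w x y = mass ω (x , y)
    κ x y = w x y * (a x * b y)

    0≤w : ∀ x y → 0# ≤ w x y
    0≤w x y = nonNegative ω (x , y)

    0≤κ : ∀ x y → 0# ≤ κ x y
    0≤κ x y = *-nonNegative (0≤w x y) (*-nonNegative (a.0≤factor x) (b.0≤factor y))

    ab≤a : ∀ x y → a x * b y ≤ a x
    ab≤a x y = ≤-respʳ (R.*-identityʳ (a x))
      (*-monoʳ-≤ (a x) (a.0≤factor x) (b.factor≤1 y))

    ab≤b : ∀ x y → a x * b y ≤ b y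
    ab≤b x y = ≤-respʳ (R.*-identityˡ (b y))
      (*-monoˡ-≤ (b y) (b.0≤factor y) (a.factor≤1 x))

    κ≤w : ∀ x y → κ x y ≤ w x y
    κ≤w x y = ≤-respʳ (R.*-identityʳ (w x y)) (*-monoʳ-≤ (w x y) (0≤w x y)
      (≤-trans (ab≤a x y) (a.factor≤1 x)))

    row-scale : ∀ x c → ∑ A (λ y → w x y * c) ≈ mass μ x * c
    row-scale x c = R.trans (R.sym (*-distribʳ-∑ A c (w x))) (R.*-congʳ (proj₁ (ω∈Ω x)))

    col-scale : ∀ y c → ∑ A (λ x → w x y * c) ≈ mass ν y * c
    col-scale y c = R.trans (R.sym (*-distribʳ-∑ A c (λ x → w x y))) (R.*-congʳ (proj₂ (ω∈Ω y)))

    row col : ⟦ A ⟧ → Carrier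
    row x = ∑ A (λ y → κ x y)
    col y = ∑ A (λ x → κ x y)

    row≤ : ∀ x → row x ≤ mass μ′ x
    row≤ x = begin
      row x                    ≤⟨ ∑-mono A (λ y → *-monoʳ-≤ (w x y) (0≤w x y) (ab≤a x y)) ⟩
      ∑ A (λ y → w x y * a x)  ≈⟨ row-scale x (a x) ⟩
      mass μ x * a x           ≤⟨ a.kept≤ x ⟩
      mass μ′ x                ∎

    col≤ : ∀ y → col y ≤ mass ν′ y
    col≤ y = begin
      col y                    ≤⟨ ∑-mono A (λ x → *-monoʳ-≤ (w x y) (0≤w x y) (ab≤b x y)) ⟩
      ∑ A (λ x → w x y * b y)  ≈⟨ col-scale y (b y) ⟩
      mass ν y * b y           ≤⟨ b.kept≤ y ⟩
      mass ν′ y                ∎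

    r q : ⟦ A ⟧ → Carrier
    r x = proj₁ (≤⇒∃+ (row≤ x))
    q y = proj₁ (≤⇒∃+ (col≤ y))

    0≤r : ∀ x → 0# ≤ r x
    0≤r x = proj₁ (proj₂ (≤⇒∃+ (row≤ x)))

    0≤q : ∀ y → 0# ≤ q y
    0≤q y = proj₁ (proj₂ (≤⇒∃+ (col≤ y)))

    row+r : ∀ x → row x + r x ≈ mass μ′ x
    row+r x = proj₂ (proj₂ (≤⇒∃+ (row≤ x)))

    col+q : ∀ y → col y + q y ≈ mass ν′ y
    col+q y = proj₂ (proj₂ (≤⇒∃+ (col≤ y)))

    T R′ : Carrier
    T = ∑ A row
    R′ = ∑ A r

    T+R : T + R′ ≈ 1#
    T+R = R.trans (R.sym (∑-+ A row r)) (R.trans (∑-cong A row+r) (total-mass μ′))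

    T+Q : T + ∑ A q ≈ 1#
    T+Q = R.trans (R.+-congʳ (∑-swap A A κ))
            (R.trans (R.sym (∑-+ A col q)) (R.trans (∑-cong A col+q) (total-mass ν′)))

    -- Both sides complement the same kept mass T to 1, because summing κ by rows or by columns
    -- gives the same total.
    Q≈R : ∑ A q ≈ R′
    Q≈R = R.+-cancelˡ T _ _ (R.trans T+Q (R.sym T+R))

    0≤R : 0# ≤ R′
    0≤R = ∑-nonNegative A 0≤r

    C : Carrier
    C = ∑ A (λ _ → 1#) + ∑ A (λ _ → 1#)

    -- (1 - a)(1 - b) ≥ 0, with both sides moved so that no subtraction occurs.
    1≤ab+a̅+b̅ : ∀ x y → 1# ≤ a x * b y + (a̅ x + b̅ y)
    1≤ab+a̅+b̅ x y = begin
      1#                         ≈⟨ R.*-identityʳ 1# ⟨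
      1# * 1#                    ≈⟨ R.*-cong (a.complement x) (b.complement y) ⟨
      (a x + a̅ x) * (b y + b̅ y)
        ≈⟨ solve 4 (λ a a̅ b b̅ → (a :+ a̅) :* (b :+ b̅) := a :* b :+ (a̅ :* (b :+ b̅) :+ a :* b̅))
             R.refl (a x) (a̅ x) (b y) (b̅ y) ⟩
      a x * b y + (a̅ x * (b y + b̅ y) + a x * b̅ y)
        ≤⟨ +-monoʳ-≤ _ (+-mono-≤ (≤-reflexive (R.*-congˡ (b.complement y)))
             (*-monoˡ-≤ (b̅ y) (b.0≤rest y) (a.factor≤1 x))) ⟩
      a x * b y + (a̅ x * 1# + 1# * b̅ y)
        ≈⟨ R.+-congˡ (R.+-cong (R.*-identityʳ (a̅ x)) (R.*-identityˡ (b̅ y))) ⟩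
      a x * b y + (a̅ x + b̅ y)    ∎

    w≤ : ∀ x y → w x y ≤ κ x y + (w x y * a̅ x + w x y * b̅ y)
    w≤ x y = begin
      w x y                                    ≈⟨ R.*-identityʳ (w x y) ⟨
      w x y * 1#                               ≤⟨ *-monoʳ-≤ (w x y) (0≤w x y) (1≤ab+a̅+b̅ x y) ⟩
      w x y * (a x * b y + (a̅ x + b̅ y))        ≈⟨ R.trans (R.distribˡ _ _ _) (R.+-congˡ (R.distribˡ _ _ _)) ⟩
      κ x y + (w x y * a̅ x + w x y * b̅ y)      ∎

    ∑∑wa̅≤ : ∑ A (λ x → ∑ A (λ y → w x y * a̅ x)) ≤ ∑ A (λ _ → 1#) * η
    ∑∑wa̅≤ = ≤-respʳ (∑-const A η)
      (∑-mono A (λ x → ≤-respˡ (R.sym (row-scale x (a̅ x))) (a.removed≤ x 0≤η (μ≤ x))))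

    ∑∑wb̅≤ : ∑ A (λ x → ∑ A (λ y → w x y * b̅ y)) ≤ ∑ A (λ _ → 1#) * η
    ∑∑wb̅≤ = ≤-respˡ (∑-swap A A _) (≤-respʳ (∑-const A η)
      (∑-mono A (λ y → ≤-respˡ (R.sym (col-scale y (b̅ y))) (b.removed≤ y 0≤η (ν≤ y)))))

    -- R′ is 1 - T, the mass that ω loses by shrinking. By `w≤` each entry loses at most its row
    -- share plus its column share, and every row and every column accounts for at most η in total.
    R≤Cη : R′ ≤ C * η
    R≤Cη = +-cancelʳ-≤ T (begin
      R′ + T                                         ≈⟨ R.trans (R.+-comm R′ T) T+R ⟩
      1#                                             ≈⟨ total-mass ω ⟨
      ∑ (A ⊗ A) (mass ω)                             ≤⟨ ∑-mono (A ⊗ A) (λ (x , y) → w≤ x y) ⟩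
      ∑ (A ⊗ A) (λ (x , y) → κ x y + (w x y * a̅ x + w x y * b̅ y))
        ≈⟨ R.trans (∑-+ (A ⊗ A) (λ (x , y) → κ x y) _)
             (R.+-congˡ (∑-+ (A ⊗ A) (λ (x , y) → w x y * a̅ x) (λ (x , y) → w x y * b̅ y))) ⟩
      T + (∑ A (λ x → ∑ A (λ y → w x y * a̅ x)) + ∑ A (λ x → ∑ A (λ y → w x y * b̅ y)))
        ≤⟨ +-monoʳ-≤ T (+-mono-≤ ∑∑wa̅≤ ∑∑wb̅≤) ⟩
      T + (∑ A (λ _ → 1#) * η + ∑ A (λ _ → 1#) * η)  ≈⟨ R.+-comm T _ ⟩
      ∑ A (λ _ → 1#) * η + ∑ A (λ _ → 1#) * η + T    ≈⟨ R.+-congʳ (R.distribʳ η _ _) ⟨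
      C * η + T                                      ∎)

    i : Carrier
    i = proj₁ (pseudoInverse R′ 0≤R)

    0≤i : 0# ≤ i
    0≤i = proj₁ (proj₂ (pseudoInverse R′ 0≤R))

    cancel : ∀ {z} → 0# ≤ z → z ≤ R′ → z * (R′ * i) ≈ z
    cancel = proj₂ (proj₂ (pseudoInverse R′ 0≤R))

    -- This is r x * q y / R′. If R′ is 0, then all r x and q y are 0 and the marginals still come
    -- out right.
    ρ : ⟦ A ⟧ → ⟦ A ⟧ → Carrier
    ρ x y = r x * (q y * i)

    0≤ρ : ∀ x y → 0# ≤ ρ x y
    0≤ρ x y = *-nonNegative (0≤r x) (*-nonNegative (0≤q y) 0≤i)

    row-ρ : ∀ x → ∑ A (λ y → ρ x y) ≈ r x
    row-ρ x = R.trans (R.sym (*-distribˡ-∑ A (r x) _))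
      (R.trans (R.*-congˡ (R.trans (R.sym (*-distribʳ-∑ A i q)) (R.*-congʳ Q≈R)))
        (cancel (0≤r x) (term≤∑ A r x 0≤r)))

    col-ρ : ∀ y → ∑ A (λ x → ρ x y) ≈ q y
    col-ρ y = R.trans (R.sym (*-distribʳ-∑ A (q y * i) r))
      (R.trans (solve 3 (λ R q i → R :* (q :* i) := q :* (R :* i)) R.refl R′ (q y) i)
        (cancel (0≤q y) (≤-respʳ Q≈R (term≤∑ A q y 0≤q))))

    left : ∀ x → ∑ A (λ y → κ x y + ρ x y) ≈ mass μ′ x
    left x = R.trans (∑-+ A _ _) (R.trans (R.+-congˡ (row-ρ x)) (row+r x))

    right : ∀ y → ∑ A (λ x → κ x y + ρ x y) ≈ mass ν′ y
    right y = R.trans (∑-+ A _ _) (R.trans (R.+-congˡ (col-ρ y)) (col+q y))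

    ω′ : 𝒟 (A ⊗ A)
    ω′ = record
      { mass        = λ (x , y) → κ x y + ρ x y
      ; nonNegative = λ (x , y) → 0≤x+y (0≤κ x y) (0≤ρ x y)
      ; total-mass  = R.trans (∑-cong A left) (total-mass μ′)
      }

    cost : ∀ d → 𝔼 ω′ (value d) ≤ 𝔼 ω (value d) + C * η
    cost d = begin
      𝔼 ω′ (value d)
        -- The kept part κ costs at most what ω costs. On the added part ρ, d is bounded by 1, so
        -- that part costs at most its mass R′.
        ≤⟨ ∑-mono (A ⊗ A) (λ p@(x , y) → ≤-respˡ (R.sym (R.distribʳ (value d p) (κ x y) (ρ x y)))
             (+-mono-≤ (*-monoˡ-≤ (value d p) (lower d p) (κ≤w x y))
               (≤-respʳ (R.*-identityʳ (ρ x y)) (*-monoʳ-≤ (ρ x y) (0≤ρ x y) (upper d p))))) ⟩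
      ∑ (A ⊗ A) (λ p → mass ω p * value d p + ρ (proj₁ p) (proj₂ p))
        ≈⟨ ∑-+ (A ⊗ A) (λ p → mass ω p * value d p) (λ (x , y) → ρ x y) ⟩
      𝔼 ω (value d) + ∑ A (λ x → ∑ A (λ y → ρ x y))
        ≈⟨ R.+-congˡ (∑-cong A row-ρ) ⟩
      𝔼 ω (value d) + R′
        ≤⟨ +-monoʳ-≤ _ R≤Cη ⟩
      𝔼 ω (value d) + C * η ∎

  -- Path sums and reachability within k steps.

  ∑-paths-cong : ∀ A k {f g} → (∀ π → f π ≈ g π) → ∑-paths A k f ≈ ∑-paths A k g
  ∑-paths-cong A zero    f≈g = f≈g []
  ∑-paths-cong A (suc k) f≈g = ∑-cong A (λ x → ∑-paths-cong A k (λ π → f≈g (x ∷ π)))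

  ∑-paths-mono : ∀ A k {f g} → (∀ π → f π ≤ g π) → ∑-paths A k f ≤ ∑-paths A k g
  ∑-paths-mono A zero    f≤g = f≤g []
  ∑-paths-mono A (suc k) f≤g = ∑-mono A (λ x → ∑-paths-mono A k (λ π → f≤g (x ∷ π)))

  *-distribˡ-∑-paths : ∀ A k c f → c * ∑-paths A k f ≈ ∑-paths A k (λ π → c * f π)
  *-distribˡ-∑-paths A zero    c f = R.refl
  *-distribˡ-∑-paths A (suc k) c f =
    R.trans (*-distribˡ-∑ A c _) (∑-cong A (λ x → *-distribˡ-∑-paths A k c _))

  cylinder-nonNegative : ∀ {A k} (P : ⟦ A ⟧ → 𝒟 A) x (π : Vec ⟦ A ⟧ k) → 0# ≤ cylinder {A} P x π
  cylinder-nonNegative     P x []      = 0≤1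
  cylinder-nonNegative {A} P x (y ∷ π) =
    *-nonNegative (nonNegative (P x) y) (cylinder-nonNegative {A} P y π)

  cylinder-total : ∀ {A} (P : ⟦ A ⟧ → 𝒟 A) x k → ∑-paths A k (cylinder {A} P x) ≈ 1#
  cylinder-total     P x zero    = R.refl
  cylinder-total {A} P x (suc k) = R.trans (∑-cong A step) (total-mass (P x))
    where
    step : ∀ y → ∑-paths A k (λ π → mass (P x) y * cylinder {A} P y π) ≈ mass (P x) y
    step y = R.trans (R.sym (*-distribˡ-∑-paths A k (mass (P x) y) _))
               (R.trans (R.*-congˡ (cylinder-total {A} P y k)) (R.*-identityʳ _))

  indicator≤1 : ∀ {Q : Set} (Q? : Dec Q) → indicator Q? ≤ 1#
  indicator≤1 (yes _) = ≤-refl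
  indicator≤1 (no  _) = 0≤1

  module _ {A} (P : ⟦ A ⟧ → 𝒟 A) {B : Pred ⟦ A ⟧ 0ℓ} (B? : Decidable B) where

    -- Replacing the indicator by 1 leaves the total mass of all cylinders of length k.
    reach≤1 : ∀ x k → reach≤ {A} P B? x k ≤ 1#
    reach≤1 x k = ≤-respʳ (cylinder-total {A} P x k) (∑-paths-mono A k λ π →
      ≤-respʳ (R.*-identityˡ _)
        (*-monoˡ-≤ _ (cylinder-nonNegative {A} P x π) (indicator≤1 (any? B? (x ∷ π)))))

    reach≤-zero : ∀ {x} → ¬ B x → reach≤ {A} P B? x 0 ≈ 0#
    reach≤-zero {x} ¬Bx with B? x
    ... | yes Bx = contradiction Bx ¬Bx
    ... | no  _  = R.zeroˡ 1#

    -- First-step analysis: a start outside B does not affect whether the path visits B, so the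
    -- probability of the first step factors out of the sum over the remaining path.
    reach≤-suc : ∀ {x} k → ¬ B x →
      reach≤ {A} P B? x (suc k) ≈ 𝔼 (P x) (λ y → reach≤ {A} P B? y k)
    reach≤-suc {x} k ¬Bx = ∑-cong A λ y →
      R.trans (∑-paths-cong A k (term y)) (R.sym (*-distribˡ-∑-paths A k (mass (P x) y) _))
      where
      skip : ∀ {k} (π : Vec ⟦ A ⟧ k) → indicator (any? B? (x ∷ π)) ≈ indicator (any? B? π)
      skip π with B? x
      ... | yes Bx = contradiction Bx ¬Bx
      ... | no  _  = R.refl

      term : ∀ y (π : Vec ⟦ A ⟧ k) →
        indicator (any? B? (x ∷ y ∷ π)) * (mass (P x) y * cylinder {A} P y π) ≈
        mass (P x) y * (indicator (any? B? (y ∷ π)) * cylinder {A} P y π)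
      term y π = R.trans (R.*-congʳ (skip (y ∷ π)))
        (solve 3 (λ i m c → i :* (m :* c) := m :* (i :* c)) R.refl _ _ _)

  -- Least fixed points and the distance on the diagonal.

  -- Restricting F below f by g ↦ F (g ⊓ f) yields a fixed point of F under f.
  leastFixedPoint≤preFixedPoint : ∀ {X} (F : UnitValued X → UnitValued X) →
    (∀ {g h} → g ≤ᵘ h → F g ≤ᵘ F h) →
    ∀ {l} → IsLeastFixedPoint F l → ∀ f → F f ≤ᵘ f → l ≤ᵘ f
  leastFixedPoint≤preFixedPoint {X} F mono {l} (_ , least) f Ff≤f x =
    ≤-trans (least g Fg≈g x) (g≤f x)
    where
    open NaturalChoiceMin totalOrder using (_⊓_; x⊓y≤x; x⊓y≤y; ⊓-glb)

    infixl 7 _⊓f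
    _⊓f : UnitValued X → UnitValued X
    h ⊓f = record
      { value = λ y → value h y ⊓ value f y
      ; lower = λ y → ⊓-glb (lower h y) (lower f y)
      ; upper = λ y → ≤-trans (x⊓y≤x _ _) (upper h y)
      }

    -- `least` compares l with fixed points only, so a genuine fixed point below f has to be
    -- produced.
    G-lfp : ∃[ g ] IsLeastFixedPoint (λ h → F (h ⊓f)) g
    G-lfp = leastFixedPoint (λ h → F (h ⊓f)) λ {g} {h} g≤h →
      mono {g ⊓f} {h ⊓f} (λ y → ⊓-glb (≤-trans (x⊓y≤x _ _) (g≤h y)) (x⊓y≤y _ _))

    g : UnitValued X
    g = proj₁ G-lfp

    G≈g : F (g ⊓f) ≈ᵘ g
    G≈g = proj₁ (proj₂ G-lfp)

    g≤f : g ≤ᵘ f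
    g≤f y = ≤-respˡ (G≈g y) (≤-trans (mono {g ⊓f} {f} (λ z → x⊓y≤y _ _) y) (Ff≤f y))

    -- Since g ≤ f, the functions g and `g ⊓f` agree pointwise, so the fixed point of the restricted
    -- map is fixed by F itself.
    Fg≈g : F g ≈ᵘ g
    Fg≈g y = antisym
      (≤-respʳ (G≈g y) (mono {g} {g ⊓f} (λ z → ⊓-glb ≤-refl (g≤f z)) y))
      (≤-respˡ (G≈g y) (mono {g ⊓f} {g} (λ z → x⊓y≤x _ _) y))

  module _ {n m} (ℓ : Fin n → Fin m) where
    open Distance ℓ

    Δ≤coupling : ∀ σ d {s t ω} → ℓ s ≡ ℓ t → Ω (σ s) (σ t) ω → value (Δ σ d) (s , t) ≤ 𝔼 ω (value d)
    Δ≤coupling σ d {s} {t} {ω} ℓs≡ℓt ω∈Ω with ℓ s Fin.≟ ℓ t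
    ... | yes _    = proj₁ (proj₂ (optimalCost σ d s t)) _ (ω , ω∈Ω , R.refl)
    ... | no ℓs≢ℓt = contradiction ℓs≡ℓt ℓs≢ℓt

    module _ (σ : Transition n) where

      δᵘ : UnitValued (Fin n × Fin n)
      δᵘ = proj₁ (distance σ)

      δ≤coupling : ∀ {s t ω} → ℓ s ≡ ℓ t → Ω (σ s) (σ t) ω → δ σ (s , t) ≤ 𝔼 ω (δ σ)
      δ≤coupling {ω = ω} ℓs≡ℓt ω∈Ω =
        ≤-respˡ (proj₁ (proj₂ (distance σ)) _) (Δ≤coupling σ δᵘ {ω = ω} ℓs≡ℓt ω∈Ω)

      -- Let d be δ with its diagonal overwritten by 0. It is a pre-fixed point of `Δ σ`: on the
      -- diagonal by the diagonal coupling, elsewhere by monotonicity from d ≤ δ. Hence δ lies below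
      -- d.
      δ-diagonal : ∀ s → δ σ (s , s) ≈ 0#
      δ-diagonal s = antisym (≤-respʳ (d-diagonal s) (δ≤d (s , s))) (lower δᵘ (s , s))
        where
        d : UnitValued (Fin n × Fin n)
        d = record { value = v ; lower = v-lower ; upper = v-upper }
          where
          v : Fin n × Fin n → Carrier
          v (u , w) = if does (u Fin.≟ w) then 0# else δ σ (u , w)

          v-lower : ∀ p → 0# ≤ v p
          v-lower (u , w) with u Fin.≟ w
          ... | yes _ = ≤-refl
          ... | no  _ = lower δᵘ (u , w)

          v-upper : ∀ p → v p ≤ 1#
          v-upper (u , w) with u Fin.≟ w
          ... | yes _ = 0≤1
          ... | no  _ = upper δᵘ (u , w)

        d-diagonal : ∀ u → value d (u , u) ≈ 0#
        d-diagonal u with u Fin.≟ u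
        ... | yes _  = R.refl
        ... | no u≢u = contradiction ≡.refl u≢u

        d≤δ : d ≤ᵘ δᵘ
        d≤δ (u , w) with u Fin.≟ w
        ... | yes _ = lower δᵘ (u , w)
        ... | no  _ = ≤-refl

        Δd≤d : Δ σ d ≤ᵘ d
        Δd≤d (u , w) with u Fin.≟ w
        ... | no  _      =
          ≤-respʳ (proj₁ (proj₂ (distance σ)) (u , w)) (Δ-mono σ {d} {δᵘ} d≤δ (u , w))
        ... | yes ≡.refl =
          let ω , ω∈Ω , cost = diagonalCoupling (σ u)
          in  ≤-respʳ (cost (value d) d-diagonal) (Δ≤coupling σ d {ω = ω} ≡.refl ω∈Ω)

        δ≤d : δᵘ ≤ᵘ d
        δ≤d = leastFixedPoint≤preFixedPoint (Δ σ) (λ {e} {f} → Δ-mono σ {e} {f})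
                {δᵘ} (proj₂ (distance σ)) d Δd≤d

  -- Following a policy for k steps in the perturbed chain.

  module _ (M : LabelledMarkovChain) where
    open LabelledMarkovChain M
    open Robust M
    open Distance ℓ

    -- Twice the number of states: the error constant of `perturbedCoupling`, one half for rows and
    -- one for columns.
    C : Carrier
    C = ∑ (fin numStates) (λ _ → 1#) + ∑ (fin numStates) (λ _ → 1#)

    0≤C : 0# ≤ C
    0≤C = 0≤x+y 0≤∑1 0≤∑1
      where
      0≤∑1 : 0# ≤ ∑ (fin numStates) (λ _ → 1#)
      0≤∑1 = ∑-nonNegative (fin numStates) (λ _ → 0≤1)

    -- This is k * C, in a recursive form that matches the accumulation of one error `C * η` per
    -- step.
    drift : ℕ → Carrier
    drift zero    = 0#
    drift (suc k) = drift k + C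

    drift-nonNegative : ∀ k → 0# ≤ drift k
    drift-nonNegative zero    = ≤-refl
    drift-nonNegative (suc k) = 0≤x+y (drift-nonNegative k) 0≤C

    module _ (P : Policy) {σ : Transition numStates} {η} (0≤η : 0# ≤ η)
             (close : ∀ s x → mass (τ s) x ≤ mass (σ s) x + η) where

      reach : ℕ → S × S → Carrier
      reach k p = reach≤ {S×S} (choose P) S²Δ? p k

      reach-suc : ∀ k {s t} → s ≢ t → reach (suc k) (s , t) ≈ 𝔼 (choose P (s , t)) (reach k)
      reach-suc k s≢t = reach≤-suc {S×S} (choose P) S²Δ? k s≢t

      -- The distance is at most the probability of missing the diagonal plus the drift. Moving
      -- `reach` to the left avoids subtraction, so that the inequality can be integrated by `𝔼-+`
      -- and `𝔼-const`.
      Bounded : ℕ → S × S → Set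
      Bounded k p = δ σ p + reach k p ≤ 1# + drift k * η

      bounded-diagonal : ∀ k s → Bounded k (s , s)
      bounded-diagonal k s = begin
        δ σ (s , s) + reach k (s , s)  ≈⟨ R.+-congʳ (δ-diagonal ℓ σ s) ⟩
        0# + reach k (s , s)           ≈⟨ R.+-identityˡ _ ⟩
        reach k (s , s)                ≤⟨ reach≤1 {S×S} (choose P) S²Δ? (s , s) k ⟩
        1#                             ≤⟨ x≤x+y (*-nonNegative (drift-nonNegative k) 0≤η) ⟩
        1# + drift k * η               ∎

      bounded-zero : ∀ {s t} → s ≢ t → Bounded 0 (s , t)
      bounded-zero {s} {t} s≢t = begin
        δ σ (s , t) + reach 0 (s , t)  ≈⟨ R.+-congˡ (reach≤-zero {S×S} (choose P) S²Δ? s≢t) ⟩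
        δ σ (s , t) + 0#               ≤⟨ +-monoˡ-≤ 0# (upper (δᵘ ℓ σ) (s , t)) ⟩
        1# + 0#                        ≈⟨ R.+-congˡ (R.zeroˡ η) ⟨
        1# + 0# * η                    ∎

      -- Under P such a pair is absorbing, so a further step leaves `reach` unchanged while the
      -- drift can only grow.
      bounded-suc-≢ : ∀ k {s t} → s ≢ t → ℓ s ≢ ℓ t → Bounded k (s , t) → Bounded (suc k) (s , t)
      bounded-suc-≢ k {s} {t} s≢t ℓs≢ℓt bounded = begin
        δ σ p + reach (suc k) p           ≈⟨ R.+-congˡ (reach-suc k s≢t) ⟩
        δ σ p + 𝔼 (choose P p) (reach k)
          ≈⟨ R.+-congˡ (𝔼-pointMass {S×S} (choose P p) p (reach k) (absorbing P p ℓs≢ℓt)) ⟩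
        δ σ p + reach k p                 ≤⟨ bounded ⟩
        1# + drift k * η                  ≤⟨ +-monoʳ-≤ 1# (*-monoˡ-≤ η 0≤η (x≤x+y 0≤C)) ⟩
        1# + drift (suc k) * η            ∎
        where
        p : S × S
        p = s , t

      -- As a fixed point, `δ σ` is bounded by its expectation under any coupling for σ. Taking the
      -- corrected coupling of P costs `C * η`; integrating the bound for k against the original
      -- coupling gives the rest.
      bounded-suc-≡ : ∀ k {s t} → s ≢ t → ℓ s ≡ ℓ t → (∀ p → Bounded k p) → Bounded (suc k) (s , t)
      bounded-suc-≡ k {s} {t} s≢t ℓs≡ℓt bounded = begin
        δ σ p + reach (suc k) p                ≈⟨ R.+-congˡ (reach-suc k s≢t) ⟩
        δ σ p + 𝔼 ω (reach k)                  ≤⟨ +-monoˡ-≤ _ (δ≤coupling ℓ σ {ω = ω′} ℓs≡ℓt ω′∈Ω) ⟩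
        𝔼 ω′ (δ σ) + 𝔼 ω (reach k)             ≤⟨ +-monoˡ-≤ _ (cost (δᵘ ℓ σ)) ⟩
        𝔼 ω (δ σ) + C * η + 𝔼 ω (reach k)
          ≈⟨ solve 3 (λ a b c → a :+ b :+ c := a :+ c :+ b) R.refl (𝔼 ω (δ σ)) (C * η) (𝔼 ω (reach k)) ⟩
        𝔼 ω (δ σ) + 𝔼 ω (reach k) + C * η      ≈⟨ R.+-congʳ (𝔼-+ ω (δ σ) (reach k)) ⟨
        𝔼 ω (λ x → δ σ x + reach k x) + C * η  ≤⟨ +-monoˡ-≤ _ (𝔼-mono ω bounded) ⟩
        𝔼 ω (λ _ → 1# + drift k * η) + C * η   ≈⟨ R.+-congʳ (𝔼-const ω _) ⟩
        1# + drift k * η + C * η               ≈⟨ R.+-assoc _ _ _ ⟩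
        1# + (drift k * η + C * η)             ≈⟨ R.+-congˡ (R.distribʳ η _ _) ⟨
        1# + drift (suc k) * η                 ∎
        where
        p : S × S
        p = s , t

        ω : 𝒟 S×S
        ω = choose P p

        ω∈Ω : Ω (τ s) (τ t) ω
        ω∈Ω = coupling P s t (inj₂ [ s≢t , (λ ℓs≢ℓt → ℓs≢ℓt ℓs≡ℓt) ]′)

        perturbed : ∃[ ω′ ] Ω (σ s) (σ t) ω′ × (∀ d → 𝔼 ω′ (value d) ≤ 𝔼 ω (value d) + C * η)
        perturbed = perturbedCoupling {μ = τ s} {τ t} {σ s} {σ t} {ω} ω∈Ω 0≤η (close s) (close t)

        ω′ : 𝒟 S×S
        ω′ = proj₁ perturbed

        ω′∈Ω : Ω (σ s) (σ t) ω′
        ω′∈Ω = proj₁ (proj₂ perturbed)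

        cost : ∀ d → 𝔼 ω′ (value d) ≤ 𝔼 ω (value d) + C * η
        cost = proj₂ (proj₂ perturbed)

      -- Induction on k. The diagonal is treated first, because the one-step unfolding of `reach` is
      -- available only off it.
      δ+reach≤1+drift : ∀ k p → Bounded k p
      δ+reach≤1+drift k (s , t) = cases k (s Fin.≟ t) (ℓ s Fin.≟ ℓ t)
        where
        cases : ∀ k → Dec (s ≡ t) → Dec (ℓ s ≡ ℓ t) → Bounded k (s , t)
        cases k       (yes ≡.refl) _           = bounded-diagonal k s
        cases zero    (no s≢t)     _           = bounded-zero s≢t
        cases (suc k) (no s≢t)     (no ℓs≢ℓt)  = bounded-suc-≢ k s≢t ℓs≢ℓt (δ+reach≤1+drift k (s , t))
        cases (suc k) (no s≢t)     (yes ℓs≡ℓt) = bounded-suc-≡ k s≢t ℓs≡ℓt (δ+reach≤1+drift k)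

    -- Choice of the number of steps and of the tolerance; continuity.

    -- The budget ε is split into two halves h: N steps bring the probability of reaching the
    -- diagonal strictly within h of 1, and η keeps the drift over N steps at most h. If ε ≤
    -- `δ σ (s , t)`, the bound for N steps would push that probability down to 1 - h. The choice of
    -- η is uniform in σ.
    δ-small : ∀ {s t} → s ≃ t → ∀ ε → 0# < ε →
      ∃[ η ] 0# < η × (∀ σ → (∀ s x → mass (τ s) x ≤ mass (σ s) x + η) → δ σ (s , t) < ε)
    δ-small {s} {t} (P , reaches) ε 0<ε with pos-divide 0≤1 0<ε
    ... | h , 0<h , 2h≈ε with reaches h 0<h
    -- Here η is h / (1 + `drift N`); the summand 1 keeps the divisor positive when N is 0.
    ... | N , converges with pos-divide (drift-nonNegative N) 0<h
    ... | η , 0<η@(0≤η , _) , eq = η , 0<η , λ σ close → ≰⇒> (λ ε≤δ →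
      <⇒≱ (converges N ℕ.≤-refl) (begin
        h           ≤⟨ +-cancelʳ-≤ ρ (≤-respʳ (R.sym (x-y+y≈x 1# ρ)) (h+ρ≤1 σ close ε≤δ)) ⟩
        1# - ρ      ≤⟨ y-x≤∣x-y∣ ρ 1# ⟩
        ∣ ρ - 1# ∣  ∎))
      where
      ρ : Carrier
      ρ = reach≤ {S×S} (choose P) S²Δ? (s , t) N

      driftη≤h : drift N * η ≤ h
      driftη≤h = ≤-respʳ eq (*-monoˡ-≤ η 0≤η (≤-respʳ (R.+-comm _ _) (x≤x+y 0≤1)))

      h+ρ≤1 : ∀ σ → (∀ s x → mass (τ s) x ≤ mass (σ s) x + η) → ε ≤ δ σ (s , t) → h + ρ ≤ 1#
      h+ρ≤1 σ close ε≤δ = +-cancelʳ-≤ h (begin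
        h + ρ + h         ≈⟨ solve 2 (λ h ρ → h :+ ρ :+ h := (con 1 :+ con 1) :* h :+ ρ) R.refl h ρ ⟩
        (1# + 1#) * h + ρ ≈⟨ R.+-congʳ 2h≈ε ⟩
        ε + ρ             ≤⟨ +-monoˡ-≤ ρ ε≤δ ⟩
        δ σ (s , t) + ρ   ≤⟨ δ+reach≤1+drift P 0≤η close N (s , t) ⟩
        1# + drift N * η  ≤⟨ +-monoʳ-≤ 1# driftη≤h ⟩
        1# + h            ∎)

    d_F<⇒close : ∀ {σ η} → d_F σ τ < η → ∀ s x → mass (τ s) x ≤ mass (σ s) x + η
    d_F<⇒close {σ} {η} (d≤η , _) s x = begin
      mass (τ s) x                  ≈⟨ x-y+y≈x _ _ ⟨
      mass (τ s) x - mass (σ s) x + mass (σ s) x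
        ≤⟨ +-monoˡ-≤ _ (y-x≤∣x-y∣ (mass (σ s) x) (mass (τ s) x)) ⟩
      diff s x + mass (σ s) x       ≤⟨ +-monoˡ-≤ _ (≤-maximum (diff s) x) ⟩
      maximum (diff s) + mass (σ s) x
        ≤⟨ +-monoˡ-≤ _ (≤-maximum (λ s′ → maximum (diff s′)) s) ⟩
      d_F σ τ + mass (σ s) x        ≤⟨ +-monoˡ-≤ _ d≤η ⟩
      η + mass (σ s) x              ≈⟨ R.+-comm _ _ ⟩
      mass (σ s) x + η              ∎
      where
      diff : S → S → Carrier
      diff s′ x′ = ∣ mass (σ s′) x′ - mass (τ s′) x′ ∣

    -- The chain τ is within any tolerance of itself, so a positive distance, taken as ε, would be
    -- smaller than itself.
    δ-robust : ∀ {s t} → s ≃ t → δ τ (s , t) ≈ 0#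
    δ-robust {s} {t} s≃t with δ τ (s , t) ≤? 0#
    ... | yes δ≤0 = antisym δ≤0 (lower (δᵘ ℓ τ) (s , t))
    ... | no  δ≰0 =
      let η , (0≤η , _) , small = δ-small s≃t (δ τ (s , t)) (≰⇒> δ≰0)
      in  contradiction R.refl (proj₂ (small τ (λ _ _ → x≤x+y 0≤η)))

    -- The reference value z is kept general up to `≈` so as to serve both for continuity, with z =
    -- `δ τ (s , t)`, and for the sequential limit, with z = `0#`.
    ∣δ-z∣<ε : ∀ {s t} → s ≃ t → ∀ ε → 0# < ε →
      ∃[ η ] 0# < η × (∀ σ → d_F σ τ < η → ∀ {z} → z ≈ 0# → ∣ δ σ (s , t) - z ∣ < ε)
    ∣δ-z∣<ε {s} {t} s≃t ε 0<ε =
      let η , 0<η , small = δ-small s≃t ε 0<ε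
      in  η , 0<η , λ σ d<η {z} z≈0 →
            let eq : δ σ (s , t) - z ≈ δ σ (s , t)
                eq = R.trans (R.+-congˡ (R.trans (R.-‿cong z≈0) R.-0#≈0#)) (R.+-identityʳ _)
                δ≤ε , δ≉ε = small σ (d_F<⇒close {σ} d<η)
            in  ∣∣<-intro (≤-respʳ (R.sym eq) (lower (δᵘ ℓ σ) (s , t)))
                  (≤-respˡ (R.sym eq) δ≤ε , λ p → δ≉ε (R.trans (R.sym eq) p))

theorem1 : (ℝ : CompleteOrderedField) → let open Probability ℝ in
    (M : LabelledMarkovChain) → let open LabelledMarkovChain M in let open Robust M in let open Distance ℓ in
    (s t : S) → s ≃ t →
    ContinuousAt (λ σ → δ σ (s , t)) τ
    × ((τₖ : ℕ → Transition numStates) → Converges τₖ τ → (λ k → δ (τₖ k) (s , t)) ⟶ 0#)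
theorem1 ℝ M s t s≃t = continuous , limit
  where
  open Probability ℝ
  open LabelledMarkovChain M
  open Distance ℓ
  open Continuity ℝ
  open CommutativeRing commutativeRing using (refl)

  continuous : ContinuousAt (λ σ → δ σ (s , t)) τ
  continuous ε 0<ε =
    let η , 0<η , near = ∣δ-z∣<ε M s≃t ε 0<ε
    in  η , 0<η , λ σ d<η → near σ d<η (δ-robust M s≃t)

  limit : (τₖ : ℕ → Transition numStates) → Converges τₖ τ → (λ k → δ (τₖ k) (s , t)) ⟶ 0#
  limit τₖ τₖ→τ ε 0<ε =
    let η , 0<η , near = ∣δ-z∣<ε M s≃t ε 0<ε
        N , close      = τₖ→τ η 0<η
    in  N , λ k N≤k → near (τₖ k) (close k N≤k) refl
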